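{- Let $m$ be a positive integer, let $p$ be a prime with $\gcd(m,p)=1$, and let $s$ be a positive integer with $p^{s}\equiv 1 \pmod m$. Then for every positive integer $n$, $$f^{(m)}_{p^{s}-1+n}(x)\equiv f^{(m)}_{n}(x) \pmod p,$$ i.e. corresponding coefficients of the two polynomials are congruent modulo $p$.
   Context: For a positive integer $m$ let $\Psi_m(x)=\sum_{j=0}^{m-1}x^j=\frac{1-x^m}{1-x}$. For an integer $k\ge 0$ let $$f_k^{(m)}(x)=\left(\tfrac1m\, x\Psi_m'(x)\right)^k \ \mathrm{rem}\ \Psi_m(x)\in\mathbb{Q}[x],$$ where $u\ \mathrm{rem}\ v$ denotes the remainder of the division of the polynomial $u$ by $v$. Since $\Psi_m$ is monic, the coefficients of $f_k^{(m)}$ lie in $\mathbb{Z}[1/m]$, so they may be reduced modulo any prime $p$ not dividing $m$ (as elements of $\mathbb{F}_p$). -}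

module Defs where

open import Data.Integer.Base as ℤ using (ℤ; +_)
import Data.Integer.Divisibility as ℤ
open import Data.List.Base using (List; []; _∷_; map; length; replicate)
open import Data.Nat.Base as ℕ using (ℕ; zero; suc; NonZero; s≤s)
open import Data.Nat.Divisibility using (_∤_)
import Data.Nat.Properties as ℕ
open import Data.Product.Base using (_×_; _,_; proj₁; proj₂)
open import Data.Rational.Base
  using (ℚ; 0ℚ; 1ℚ; _/_; _+_; _*_; -_; ↥_; ↧_; ↧ₙ_)
open import Data.Rational.Properties
  using (+-identityˡ; +-identityʳ; *-zeroʳ)
open import Data.Rational.Solver using (module +-*-Solver)
open import Relation.Binary.PropositionalEquality

-- ℚ[x]: coefficient lists, constant term first.  Trailing zeros are allowed, so
-- polynomials are to be compared through coeff and not with _≡_ on lists.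
Poly : Set
Poly = List ℚ

coeff : Poly → ℕ → ℚ
coeff []      _       = 0ℚ
coeff (a ∷ _) zero    = a
coeff (_ ∷ u) (suc i) = coeff u i

infixl 6 _+ₚ_ _-ₚ_
infixl 7 _*ₚ_ _·ₚ_ _rem_
infixr 8 _^ₚ_

_+ₚ_ : Poly → Poly → Poly
[]      +ₚ v       = v
(a ∷ u) +ₚ []      = a ∷ u
(a ∷ u) +ₚ (b ∷ v) = (a + b) ∷ (u +ₚ v)

_·ₚ_ : ℚ → Poly → Poly
c ·ₚ u = map (c *_) u

_-ₚ_ : Poly → Poly → Poly
u -ₚ v = u +ₚ ((- 1ℚ) ·ₚ v)

X·_ : Poly → Poly
X· u = 0ℚ ∷ u

_*ₚ_ : Poly → Poly → Poly
[]      *ₚ v = []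
(a ∷ u) *ₚ v = (a ·ₚ v) +ₚ (X· (u *ₚ v))

_^ₚ_ : Poly → ℕ → Poly
u ^ₚ zero  = 1ℚ ∷ []
u ^ₚ suc k = u *ₚ (u ^ₚ k)

-- derivFrom k [a₀, a₁, …] = [k a₀, (k + 1) a₁, …]
derivFrom : ℕ → Poly → Poly
derivFrom k []      = []
derivFrom k (a ∷ u) = ((+ k / 1) * a) ∷ derivFrom (suc k) u

deriv : Poly → Poly
deriv []      = []
deriv (_ ∷ u) = derivFrom 1 u

-- The degree, provided the last entry of the list is nonzero.
deg : Poly → ℕ
deg v = length v ℕ.∸ 1

Monic : Poly → Set
Monic v = coeff v (deg v) ≡ 1ℚ

-- Quotient and remainder on division by a monic v, one coefficient of the
-- dividend at a time: if u = q v + r with deg r < deg v and c is the coefficient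
-- of x^(deg v) in a + x r, then a + x u = (c + x q) v + (a + x r - c v).
quotRem : Poly → Poly → Poly × Poly
quotRem []      v = [] , []
quotRem (a ∷ u) v =
  let (q , r) = quotRem u v
      c       = coeff (a ∷ r) (deg v)
  in  (c ∷ q) , ((a ∷ r) -ₚ (c ·ₚ v))

_quot_ : Poly → Poly → Poly
u quot v = proj₁ (quotRem u v)

_rem_ : Poly → Poly → Poly
u rem v = proj₂ (quotRem u v)

Ψ : ℕ → Poly
Ψ m = replicate m 1ℚ

f : (m : ℕ) .{{_ : NonZero m}} → ℕ → Poly
f m k = (((+ 1 / m) ·ₚ (X· (deriv (Ψ m)))) ^ₚ k) rem (Ψ m)

-- For p prime: a and b both lie in the localization ℤ₍ₚ₎ and have the same image
-- in 𝔽ₚ.  Given that p divides neither denominator, a - b ∈ p ℤ₍ₚ₎ amounts to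
-- the divisibility below.
infix 4 _≈_[mod_]
record _≈_[mod_] (a b : ℚ) (p : ℕ) : Set where
  constructor mk≈
  field
    integralˡ : p ∤ ↧ₙ a
    integralʳ : p ∤ ↧ₙ b
    congruent : (+ p) ℤ.∣ (↥ a ℤ.* ↧ b ℤ.- ↥ b ℤ.* ↧ a)

infix 4 _≈ₚ_[mod_]
_≈ₚ_[mod_] : Poly → Poly → ℕ → Set
u ≈ₚ v [mod p ] = ∀ i → coeff u i ≈ coeff v i [mod p ]

-- Correctness of division: u = (u quot v) v + (u rem v), and u rem v has degree
-- less than deg v when v is monic.  The divisors Ψ m with m > 0 are monic.

coeff-+ₚ : ∀ u v i → coeff (u +ₚ v) i ≡ coeff u i + coeff v i
coeff-+ₚ []      v       i       = sym (+-identityˡ (coeff v i))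
coeff-+ₚ (a ∷ u) []      i       = sym (+-identityʳ (coeff (a ∷ u) i))
coeff-+ₚ (a ∷ u) (b ∷ v) zero    = refl
coeff-+ₚ (a ∷ u) (b ∷ v) (suc i) = coeff-+ₚ u v i

coeff-·ₚ : ∀ c u i → coeff (c ·ₚ u) i ≡ c * coeff u i
coeff-·ₚ c []      i       = sym (*-zeroʳ c)
coeff-·ₚ c (a ∷ u) zero    = refl
coeff-·ₚ c (a ∷ u) (suc i) = coeff-·ₚ c u i

coeff-sub : ∀ w c v i →
            coeff (w -ₚ (c ·ₚ v)) i ≡ coeff w i + (- 1ℚ) * (c * coeff v i)
coeff-sub w c v i = begin
  coeff (w -ₚ (c ·ₚ v)) i                       ≡⟨ coeff-+ₚ w _ i ⟩
  coeff w i + coeff ((- 1ℚ) ·ₚ (c ·ₚ v)) i      ≡⟨ cong (λ t → coeff w i + t) (coeff-·ₚ (- 1ℚ) (c ·ₚ v) i) ⟩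
  coeff w i + (- 1ℚ) * coeff (c ·ₚ v) i         ≡⟨ cong (λ t → coeff w i + (- 1ℚ) * t) (coeff-·ₚ c v i) ⟩
  coeff w i + (- 1ℚ) * (c * coeff v i)          ∎
  where open ≡-Reasoning

private
  cancel : ∀ y z x → (y + z) + (x + (- 1ℚ) * y) ≡ z + x
  cancel = solve 3 (λ y z x → (y :+ z) :+ (x :+ con (- 1ℚ) :* y) := z :+ x) refl
    where open +-*-Solver

quotRem-correct : ∀ u v i →
  coeff u i ≡ coeff (((u quot v) *ₚ v) +ₚ (u rem v)) i
quotRem-correct []      v i = refl
quotRem-correct (a ∷ u) v i = sym (begin
  coeff (((c ·ₚ v) +ₚ (X· qv)) +ₚ (w -ₚ (c ·ₚ v))) i
    ≡⟨ coeff-+ₚ ((c ·ₚ v) +ₚ (X· qv)) _ i ⟩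
  coeff ((c ·ₚ v) +ₚ (X· qv)) i + coeff (w -ₚ (c ·ₚ v)) i
    ≡⟨ cong₂ _+_ (coeff-+ₚ (c ·ₚ v) (X· qv) i) (coeff-sub w c v i) ⟩
  (coeff (c ·ₚ v) i + coeff (X· qv) i) + (coeff w i + (- 1ℚ) * (c * coeff v i))
    ≡⟨ cong (λ t → (t + coeff (X· qv) i) + (coeff w i + (- 1ℚ) * (c * coeff v i)))
            (coeff-·ₚ c v i) ⟩
  (c * coeff v i + coeff (X· qv) i) + (coeff w i + (- 1ℚ) * (c * coeff v i))
    ≡⟨ cancel (c * coeff v i) (coeff (X· qv) i) (coeff w i) ⟩
  coeff (X· qv) i + coeff w i
    ≡⟨ shifted i ⟩
  coeff (a ∷ u) i ∎)
  where
  open ≡-Reasoning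
  r qv w : Poly
  r  = u rem v
  qv = (u quot v) *ₚ v
  w  = a ∷ r
  c : ℚ
  c = coeff w (deg v)
  shifted : ∀ j → coeff (X· qv) j + coeff w j ≡ coeff (a ∷ u) j
  shifted zero    = +-identityˡ a
  shifted (suc j) = trans (sym (coeff-+ₚ qv r j)) (sym (quotRem-correct u v j))

coeff-≥length : ∀ v i → length v ℕ.≤ i → coeff v i ≡ 0ℚ
coeff-≥length []      i       _         = refl
coeff-≥length (a ∷ v) (suc i) (s≤s l≤i) = coeff-≥length v i l≤i

private
  cancel-1 : ∀ c → c + (- 1ℚ) * (c * 1ℚ) ≡ 0ℚ
  cancel-1 = solve 1 (λ c → c :+ con (- 1ℚ) :* (c :* con 1ℚ) := con 0ℚ) refl
    where open +-*-Solver

  cancel-0 : ∀ c → 0ℚ + (- 1ℚ) * (c * 0ℚ) ≡ 0ℚ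
  cancel-0 = solve 1 (λ c → con 0ℚ :+ con (- 1ℚ) :* (c :* con 0ℚ) := con 0ℚ) refl
    where open +-*-Solver

  length≤1+deg : ∀ v → length v ℕ.≤ suc (deg v)
  length≤1+deg []      = ℕ.z≤n
  length≤1+deg (_ ∷ v) = ℕ.≤-refl

rem-deg< : ∀ u v → Monic v → ∀ i → deg v ℕ.≤ i → coeff (u rem v) i ≡ 0ℚ
rem-deg< []      v monic i d≤i = refl
rem-deg< (a ∷ u) v monic i d≤i =
  trans (coeff-sub w c v i) (go i (ℕ.m≤n⇒m<n∨m≡n d≤i))
  where
  open import Data.Sum.Base using (_⊎_; inj₁; inj₂)
  w : Poly
  w = a ∷ (u rem v)
  c : ℚ
  c = coeff w (deg v)
  go : ∀ j → deg v ℕ.< j ⊎ deg v ≡ j → coeff w j + (- 1ℚ) * (c * coeff v j) ≡ 0ℚ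
  go j (inj₂ refl) =
    trans (cong (λ t → c + (- 1ℚ) * (c * t)) monic) (cancel-1 c)
  go (suc j) (inj₁ (s≤s d≤j)) =
    trans (cong₂ (λ s t → s + (- 1ℚ) * (c * t))
                 (rem-deg< u v monic j d≤j)
                 (coeff-≥length v (suc j) (ℕ.≤-trans (length≤1+deg v) (s≤s d≤j))))
          (cancel-0 c)

Ψ-monic : ∀ m .{{_ : NonZero m}} → Monic (Ψ m)
Ψ-monic (suc zero)    = refl
Ψ-monic (suc (suc m)) = Ψ-monic (suc m)

{-# OPTIONS --safe #-}

-- Let A = ℤ₍ₚ₎[x]/(Ψ m, p) and q = p ^ s.  A has characteristic p, so a ↦ a ^ q is a
-- ring endomorphism of A, and its fixed points are closed under sums, products and
-- inverses.  As Ψ m vanishes in A, x ^ m = 1, whence x ^ q = x because q ≡ 1 mod m.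
-- Hence g = x Ψ′ / m, a polynomial in x with coefficients among the fixed points, is
-- itself fixed, and g ^ (q - 1 + n) = g ^ q g ^ (n - 1) = g ^ n.  Uniqueness of division
-- with remainder by the monic Ψ m turns this into the congruence of remainders.

module Submission where

open import Algebra.Bundles using (CommutativeMonoid; CommutativeSemiring)
import Algebra.Properties.Group
open import Algebra.Structures.Biased using (isCommutativeSemiringˡ)
open import Data.Empty using (⊥-elim)
open import Data.Fin.Base using (Fin; zero; suc; toℕ; inject₁; fromℕ)
import Data.Fin.Properties as Fin
open import Data.Integer.Base as ℤ using (+_; ∣_∣)
import Data.Integer.Properties as ℤ
open import Data.List.Base using ([]; _∷_; replicate)
open import Data.List.Relation.Unary.All using (All; []; _∷_)
import Data.List.Relation.Unary.All.Properties as All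
open import Data.Nat.Base as ℕ using (ℕ; NonZero; zero; suc; _!)
open import Data.Nat.Combinatorics using (_C_; nCn≡1; nCk≡n!/k![n-k]!; k![n∸k]!∣n!)
open import Data.Nat.Divisibility
  using (_∣_; _∤_; divides; ∣-refl; ∣-trans; ∣⇒≤; m∣m*n; ∣m⇒∣m*n)
open import Data.Nat.DivMod using (m/n*n≡m; m≡m%n+[m/n]*n)
open import Data.Nat.GCD using (gcd; gcd-greatest)
open import Data.Nat.Primality using (Prime; euclidsLemma; prime⇒nonZero; prime⇒nonTrivial)
import Data.Nat.Properties as ℕ
open import Data.Product.Base using (Σ; ∃₂; _,_; proj₁; proj₂)
open import Data.Rational.Base using (ℚ; 0ℚ; 1ℚ; -_; ↥_; ↧_; ↧ₙ_; _/_; toℚᵘ)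
  renaming (_+_ to _+ℚ_; _*_ to _*ℚ_)
import Data.Rational.Properties as ℚ
open import Data.Rational.Solver using (module +-*-Solver)
import Data.Rational.Unnormalised.Base as ℚᵘ
import Data.Rational.Unnormalised.Properties as ℚᵘ
open import Data.Sum.Base using (inj₁; inj₂; [_,_]′)
open import Function.Base using (_∘_)
open import Level using (Level; 0ℓ; _⊔_)
open import Relation.Binary.Bundles using (Setoid)
open import Relation.Binary.PropositionalEquality as ≡ using (_≡_)
open import Relation.Binary.Structures using (IsEquivalence)
open import Relation.Unary using (Pred; _∈_)
open import Defs

-- The Frobenius endomorphism in characteristic p

-- The binomial theorem and the laws of exponents hold in every commutative semiring, so A is built
-- as one and no additive inverses are carried along. The obstacle is that the data live in ℚ[x],
-- where `p` is a unit and generates everything. Hence A is a quotient of the subsemiring of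
-- polynomials with denominators prime to `p`, by an ideal of that subsemiring, and each element
-- carries its integrality proof. Coprimality of `m` and `p` enters where 1/m has to be such a
-- coefficient. The way back works because `rem` is linear over all of ℚ, so the factor `p` can be
-- pulled out of it.

prime∤1 : ∀ {p} → Prime p → p ∤ 1
prime∤1 {p} pr p∣1 = ℕ.<⇒≱ (ℕ.nonTrivial⇒n>1 p {{prime⇒nonTrivial pr}}) (∣⇒≤ p∣1)

prime∤! : ∀ {p k} → Prime p → k ℕ.< p → p ∤ k !
prime∤! {p} {zero}  pr _ p∣1 = prime∤1 pr p∣1
prime∤! {p} {suc k} pr k<p p∣k! with euclidsLemma (suc k) (k !) pr p∣k!
... | inj₁ p∣k = ℕ.<⇒≱ k<p (∣⇒≤ p∣k)
... | inj₂ p∣k = prime∤! pr (ℕ.<-trans (ℕ.n<1+n k) k<p) p∣k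

-- In C(p, k) k! (p - k)! = p! the prime divides the right side but neither factorial on the left,
-- since both `k` and p - k are below `p`.
prime∣C : ∀ {p k} → Prime p → 0 ℕ.< k → k ℕ.< p → p ∣ p C k
prime∣C {p@(suc p-1)} {k} pr 0<k k<p
  with euclidsLemma (p C k) (k ! ℕ.* (p ℕ.∸ k) !) pr
         (≡.subst (p ∣_) (≡.sym C*k!≡p!) (m∣m*n (p-1 !)))
  where
  instance _ = ℕ._!*_!≢0 k (p ℕ.∸ k)
  C*k!≡p! : (p C k) ℕ.* (k ! ℕ.* (p ℕ.∸ k) !) ≡ p !
  C*k!≡p! = ≡.trans (≡.cong (ℕ._* (k ! ℕ.* (p ℕ.∸ k) !)) (nCk≡n!/k![n-k]! (ℕ.<⇒≤ k<p)))
                    (m/n*n≡m (k![n∸k]!∣n! (ℕ.<⇒≤ k<p)))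
... | inj₁ p∣C = p∣C
... | inj₂ p∣k! with euclidsLemma (k !) ((p ℕ.∸ k) !) pr p∣k!
...   | inj₁ p∣k!   = ⊥-elim (prime∤! pr k<p p∣k!)
...   | inj₂ p∣p-k! = ⊥-elim (prime∤! pr (ℕ.∸-monoʳ-< 0<k (ℕ.<⇒≤ k<p)) p∣p-k!)

module Frobenius {c ℓ} (R : CommutativeSemiring c ℓ) where
  open CommutativeSemiring R hiding (zero)
  open import Algebra.Properties.CommutativeSemiring.Exp R
  open import Algebra.Properties.Semiring.Mult semiring
    using (_×_; ×-assoc-*; ×-congʳ; ×-congˡ; ×-assocˡ; ×-homo-1)
  open import Algebra.Properties.Semiring.Sum semiring
    using (sum; sum-cong-≋; sum-init-last; sum-replicate-zero)
  import Algebra.Properties.CommutativeSemiring.Binomial R as Binomial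
  open import Relation.Binary.Reasoning.Setoid setoid

  1^n≈1 : ∀ n → 1# ^ n ≈ 1#
  1^n≈1 zero    = refl
  1^n≈1 (suc n) = trans (*-identityˡ _) (1^n≈1 n)

  ^-% : ∀ x m .{{_ : NonZero m}} → x ^ m ≈ 1# → ∀ k → x ^ k ≈ x ^ (k ℕ.% m)
  ^-% x m xᵐ≈1 k = begin
    x ^ k                                 ≈⟨ ^-congʳ x (m≡m%n+[m/n]*n k m) ⟩
    x ^ (k ℕ.% m ℕ.+ k ℕ./ m ℕ.* m)       ≈⟨ ^-homo-* x (k ℕ.% m) (k ℕ./ m ℕ.* m) ⟩
    x ^ (k ℕ.% m) * x ^ (k ℕ./ m ℕ.* m)   ≈⟨ *-congˡ (^-congʳ x (ℕ.*-comm (k ℕ./ m) m)) ⟩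
    x ^ (k ℕ.% m) * x ^ (m ℕ.* (k ℕ./ m)) ≈⟨ *-congˡ (^-assocʳ x m (k ℕ./ m)) ⟨
    x ^ (k ℕ.% m) * (x ^ m) ^ (k ℕ./ m)   ≈⟨ *-congˡ (^-congˡ (k ℕ./ m) xᵐ≈1) ⟩
    x ^ (k ℕ.% m) * 1# ^ (k ℕ./ m)        ≈⟨ *-congˡ (1^n≈1 (k ℕ./ m)) ⟩
    x ^ (k ℕ.% m) * 1#                    ≈⟨ *-identityʳ _ ⟩
    x ^ (k ℕ.% m)                         ∎

  module _ {p} (pr : Prime p) (p×1≈0 : p × 1# ≈ 0#) where

    p∣n⇒n×x≈0 : ∀ {n} → p ∣ n → ∀ x → n × x ≈ 0#
    p∣n⇒n×x≈0 {n} (divides k n≡k*p) x = begin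
      n × x              ≈⟨ ×-congˡ (≡.trans n≡k*p (ℕ.*-comm k p)) ⟩
      (p ℕ.* k) × x      ≈⟨ ×-assocˡ x p k ⟨
      p × (k × x)        ≈⟨ ×-congʳ p (*-identityˡ _) ⟨
      p × (1# * (k × x)) ≈⟨ ×-assoc-* p 1# (k × x) ⟨
      p × 1# * (k × x)   ≈⟨ *-congʳ p×1≈0 ⟩
      0# * (k × x)       ≈⟨ zeroˡ _ ⟩
      0#                 ∎

    ^p-distrib-+ : ∀ x y → (x + y) ^ p ≈ x ^ p + y ^ p
    ^p-distrib-+ x y = helper p ≡.refl
      where
      -- Splitting off the first and the last binomial term needs a successor as exponent, so `p` is
      -- replaced by an `n` equal to it; primality excludes 0.
      helper : ∀ n → n ≡ p → (x + y) ^ n ≈ x ^ n + y ^ n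
      helper zero    ≡.refl = ⊥-elim (ℕ.≢-nonZero⁻¹ 0 {{prime⇒nonZero pr}} ≡.refl)
      helper (suc n) ≡.refl = begin
        (x + y) ^ suc n
          ≈⟨ Binomial.theorem (suc n) x y ⟩
        term zero + sum (term ∘ suc)
          ≈⟨ +-congˡ (sum-init-last (term ∘ suc)) ⟩
        term zero + (sum (term ∘ suc ∘ inject₁) + term (fromℕ (suc n)))
          ≈⟨ +-cong (trans (×-homo-1 _) (*-identityˡ _)) (+-cong inner top) ⟩
        y ^ suc n + (0# + x ^ suc n)
          ≈⟨ +-congˡ (+-identityˡ _) ⟩
        y ^ suc n + x ^ suc n
          ≈⟨ +-comm _ _ ⟩
        x ^ suc n + y ^ suc n ∎
        where
        term : Fin (suc (suc n)) → Carrier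
        term = Binomial.binomialTerm x y (suc n)

        inner : sum (term ∘ suc ∘ inject₁) ≈ 0#
        inner = trans
          -- The indices are i + 1 with i < n, where p = n + 1, hence strictly between 0 and `p`.
          (sum-cong-≋ λ i → p∣n⇒n×x≈0
            (prime∣C pr (ℕ.s≤s ℕ.z≤n)
              (ℕ.s≤s (≡.subst (ℕ._< n) (≡.sym (Fin.toℕ-inject₁ i)) (Fin.toℕ<n i)))) _)
          (sum-replicate-zero n)

        top : term (fromℕ (suc n)) ≈ x ^ suc n
        top = begin
          (suc n C k) × (x ^ k * y ^ (suc n ℕ.∸ k))
            ≡⟨ ≡.cong (λ j → (suc n C j) × (x ^ j * y ^ (suc n ℕ.∸ j))) (Fin.toℕ-fromℕ (suc n)) ⟩
          (suc n C suc n) × (x ^ suc n * y ^ (n ℕ.∸ n))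
            ≡⟨ ≡.cong₂ (λ c j → c × (x ^ suc n * y ^ j)) (nCn≡1 (suc n)) (ℕ.n∸n≡0 n) ⟩
          1 × (x ^ suc n * 1#)  ≈⟨ ×-homo-1 _ ⟩
          x ^ suc n * 1#        ≈⟨ *-identityʳ _ ⟩
          x ^ suc n             ∎
          where k = toℕ (fromℕ (suc n))

    ^pˢ-distrib-+ : ∀ s x y → (x + y) ^ (p ℕ.^ s) ≈ x ^ (p ℕ.^ s) + y ^ (p ℕ.^ s)
    ^pˢ-distrib-+ zero    x y = trans (*-identityʳ _) (sym (+-cong (*-identityʳ x) (*-identityʳ y)))
    ^pˢ-distrib-+ (suc s) x y = begin
      (x + y) ^ (p ℕ.* q)             ≈⟨ ^-assocʳ (x + y) p q ⟨
      ((x + y) ^ p) ^ q               ≈⟨ ^-congˡ q (^p-distrib-+ x y) ⟩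
      (x ^ p + y ^ p) ^ q             ≈⟨ ^pˢ-distrib-+ s (x ^ p) (y ^ p) ⟩
      (x ^ p) ^ q + (y ^ p) ^ q       ≈⟨ +-cong (^-assocʳ x p q) (^-assocʳ y p q) ⟩
      x ^ (p ℕ.* q) + y ^ (p ℕ.* q)   ∎
      where q = p ℕ.^ s

    -- Fixed points of the iterated Frobenius map

    module Fixed (s : ℕ) where

      Fixed : Carrier → Set ℓ
      Fixed x = x ^ (p ℕ.^ s) ≈ x

      fixed-0 : Fixed 0#
      fixed-0 = helper (p ℕ.^ s) (ℕ.m^n≢0 p s {{prime⇒nonZero pr}})
        where
        -- As 0 ^ 0 is 1, the exponent must be known to be positive.
        helper : ∀ k → NonZero k → 0# ^ k ≈ 0#
        helper (suc k) _ = zeroˡ _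

      fixed-1 : Fixed 1#
      fixed-1 = 1^n≈1 (p ℕ.^ s)

      fixed-+ : ∀ {x y} → Fixed x → Fixed y → Fixed (x + y)
      fixed-+ fx fy = trans (^pˢ-distrib-+ s _ _) (+-cong fx fy)

      fixed-* : ∀ {x y} → Fixed x → Fixed y → Fixed (x * y)
      fixed-* {x} {y} fx fy = trans (^-distrib-* x y (p ℕ.^ s)) (*-cong fx fy)

      fixed-cong : ∀ {x y} → x ≈ y → Fixed x → Fixed y
      fixed-cong x≈y fx = trans (^-congˡ (p ℕ.^ s) (sym x≈y)) (trans fx x≈y)

      -- Multiplicativity makes y ^ q an inverse of x ^ q = x, and inverses are unique. Needed for
      -- the coefficient 1/m.
      fixed-inverse : ∀ {x y} → x * y ≈ 1# → Fixed x → Fixed y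
      fixed-inverse {x} {y} xy≈1 fx = begin
        y ^ q             ≈⟨ *-identityʳ _ ⟨
        y ^ q * 1#        ≈⟨ *-congˡ xy≈1 ⟨
        y ^ q * (x * y)   ≈⟨ *-assoc _ _ _ ⟨
        y ^ q * x * y     ≈⟨ *-congʳ (*-congˡ fx) ⟨
        y ^ q * x ^ q * y ≈⟨ *-congʳ (^-distrib-* y x q) ⟨
        (y * x) ^ q * y   ≈⟨ *-congʳ (^-congˡ q (trans (*-comm y x) xy≈1)) ⟩
        1# ^ q * y        ≈⟨ *-congʳ (1^n≈1 q) ⟩
        1# * y            ≈⟨ *-identityˡ y ⟩
        y                 ∎
        where q = p ℕ.^ s

      fixed-root : ∀ {x} m .{{_ : NonZero m}} → x ^ m ≈ 1# → (p ℕ.^ s) ℕ.% m ≡ 1 ℕ.% m → Fixed x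
      fixed-root {x} m xᵐ≈1 q≡1 = begin
        x ^ q         ≈⟨ ^-% x m xᵐ≈1 q ⟩
        x ^ (q ℕ.% m) ≡⟨ ≡.cong (x ^_) q≡1 ⟩
        -- The exponent 1 is reduced as well: for m = 1 the remainder 1 % m is 0.
        x ^ (1 ℕ.% m) ≈⟨ ^-% x m xᵐ≈1 1 ⟨
        x ^ 1         ≈⟨ *-identityʳ x ⟩
        x             ∎
        where q = p ℕ.^ s

      fixed-period : ∀ {x} → Fixed x → ∀ n .{{_ : NonZero n}} → x ^ (p ℕ.^ s ℕ.∸ 1 ℕ.+ n) ≈ x ^ n
      fixed-period {x} fx (suc n) = begin
        -- One factor taken from `suc n` completes q - 1 to q; the truncated subtraction is exact
        -- because `q` is nonzero.
        x ^ (q ℕ.∸ 1 ℕ.+ suc n)       ≡⟨ ≡.cong (x ^_) (ℕ.+-suc (q ℕ.∸ 1) n) ⟩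
        x ^ (suc (q ℕ.∸ 1) ℕ.+ n)     ≡⟨ ≡.cong (λ k → x ^ (k ℕ.+ n)) (ℕ.suc-pred q) ⟩
        x ^ (q ℕ.+ n)                 ≈⟨ ^-homo-* x q n ⟩
        x ^ q * x ^ n                 ≈⟨ *-congʳ fx ⟩
        x ^ suc n                     ∎
        where
        q = p ℕ.^ s
        instance _ = ℕ.m^n≢0 p s {{prime⇒nonZero pr}}

-- Quotients of subsemirings

module _ {c ℓ} (R : CommutativeSemiring c ℓ) where
  open CommutativeSemiring R

  -- `J` absorbs only factors from `S`, so it is an ideal relative to `S`; this leaves room for `p`
  -- to be a unit in the ambient semiring.
  module SubQuotient
    {s j : Level} (S : Pred Carrier s)
    (0∈S : 0# ∈ S) (1∈S : 1# ∈ S)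
    (+∈S : ∀ {x y} → x ∈ S → y ∈ S → x + y ∈ S)
    (*∈S : ∀ {x y} → x ∈ S → y ∈ S → x * y ∈ S)
    (J : Pred Carrier j)
    (0∈J : 0# ∈ J)
    (+∈J : ∀ {x y} → x ∈ J → y ∈ J → x + y ∈ J)
    (*∈J : ∀ {x y} → x ∈ S → y ∈ J → x * y ∈ J)
    where
    open import Relation.Binary.Reasoning.Setoid setoid
    open import Algebra.Properties.CommutativeSemigroup +-commutativeSemigroup
      using (interchange; xy∙z≈xz∙y)

    -- The two-sided form makes ∼ symmetric without subtraction.
    infix 4 _∼_
    record _∼_ (x y : Carrier) : Set (c ⊔ ℓ ⊔ j) where
      constructor mk∼
      field
        {i k} : Carrier
        i∈J   : i ∈ J
        k∈J   : k ∈ J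
        x+i≈y+k : x + i ≈ y + k

    ≈⇒∼ : ∀ {x y} → x ≈ y → x ∼ y
    ≈⇒∼ x≈y = mk∼ 0∈J 0∈J (+-congʳ x≈y)

    ∼-sym : ∀ {x y} → x ∼ y → y ∼ x
    ∼-sym (mk∼ i∈J k∈J e) = mk∼ k∈J i∈J (sym e)

    ∼-trans : ∀ {x y z} → x ∼ y → y ∼ z → x ∼ z
    ∼-trans {x} {y} {z} (mk∼ {i} {k} i∈J k∈J e) (mk∼ {i'} {k'} i'∈J k'∈J e') =
      mk∼ (+∈J i∈J i'∈J) (+∈J k'∈J k∈J) (begin
        x + (i + i')  ≈⟨ +-assoc x i i' ⟨
        x + i + i'    ≈⟨ +-congʳ e ⟩
        y + k + i'    ≈⟨ xy∙z≈xz∙y y k i' ⟩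
        y + i' + k    ≈⟨ +-congʳ e' ⟩
        z + k' + k    ≈⟨ +-assoc z k' k ⟩
        z + (k' + k)  ∎)

    ∼-+-cong : ∀ {x y x' y'} → x ∼ y → x' ∼ y' → x + x' ∼ y + y'
    ∼-+-cong (mk∼ i∈J k∈J e) (mk∼ i'∈J k'∈J e') =
      mk∼ (+∈J i∈J i'∈J) (+∈J k∈J k'∈J)
          (trans (interchange _ _ _ _) (trans (+-cong e e') (interchange _ _ _ _)))

    ∼-*-congˡ : ∀ {x y z} → z ∈ S → x ∼ y → z * x ∼ z * y
    ∼-*-congˡ {z = z} z∈S (mk∼ i∈J k∈J e) =
      mk∼ (*∈J z∈S i∈J) (*∈J z∈S k∈J)
          (trans (sym (distribˡ z _ _)) (trans (*-congˡ e) (distribˡ z _ _)))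

    -- The product x x' is changed to y x' and then to y y'. Each change multiplies ideal elements
    -- by the factor that stays, so `x'` and `y` must lie in `S`.
    ∼-*-cong : ∀ {x y x' y'} → y ∈ S → x' ∈ S → x ∼ y → x' ∼ y' → x * x' ∼ y * y'
    ∼-*-cong y∈S x'∈S x∼y x'∼y' =
      ∼-trans (≈⇒∼ (*-comm _ _))
      (∼-trans (∼-*-congˡ x'∈S x∼y)
      (∼-trans (≈⇒∼ (*-comm _ _)) (∼-*-congˡ y∈S x'∼y')))

    -- A record, so that x and y can be inferred from the type of a proof.
    infix 4 _≋_
    record _≋_ (x y : Σ Carrier S) : Set (c ⊔ ℓ ⊔ j) where
      constructor mk≋
      field rel : proj₁ x ∼ proj₁ y
    open _≋_ public

    subQuotient : CommutativeSemiring (c ⊔ s) (c ⊔ ℓ ⊔ j)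
    subQuotient = record
      { Carrier = Σ Carrier S
      ; _≈_ = _≋_
      ; _+_ = λ (x , x∈S) (y , y∈S) → x + y , +∈S x∈S y∈S
      ; _*_ = λ (x , x∈S) (y , y∈S) → x * y , *∈S x∈S y∈S
      ; 0# = 0# , 0∈S
      ; 1# = 1# , 1∈S
      ; isCommutativeSemiring = isCommutativeSemiringˡ record
        { +-isCommutativeMonoid = record
          { isMonoid = record
            { isSemigroup = record
              { isMagma = record
                { isEquivalence = ≋-isEquivalence
                ; ∙-cong = λ (mk≋ e) (mk≋ e') → mk≋ (∼-+-cong e e')
                }
              ; assoc = λ x y z → lift (+-assoc _ _ _)
              }
            ; identity = (λ x → lift (+-identityˡ _)) , (λ x → lift (+-identityʳ _))
            }
          ; comm = λ x y → lift (+-comm _ _)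
          }
        ; *-isCommutativeMonoid = record
          { isMonoid = record
            { isSemigroup = record
              { isMagma = record
                { isEquivalence = ≋-isEquivalence
                ; ∙-cong = λ {_} {y} {x'} (mk≋ e) (mk≋ e') → mk≋ (∼-*-cong (proj₂ y) (proj₂ x') e e')
                }
              ; assoc = λ x y z → lift (*-assoc _ _ _)
              }
            ; identity = (λ x → lift (*-identityˡ _)) , (λ x → lift (*-identityʳ _))
            }
          ; comm = λ x y → lift (*-comm _ _)
          }
        ; distribʳ = λ x y z → lift (distribʳ _ _ _)
        ; zeroˡ = λ x → lift (zeroˡ _)
        }
      }
      where
      lift : ∀ {x y} → proj₁ x ≈ proj₁ y → x ≋ y
      lift e = mk≋ (≈⇒∼ e)

      ≋-isEquivalence : IsEquivalence _≋_
      ≋-isEquivalence = record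
        { refl  = lift refl
        ; sym   = λ (mk≋ e) → mk≋ (∼-sym e)
        ; trans = λ (mk≋ e) (mk≋ e') → mk≋ (∼-trans e e')
        }

-- The semiring ℚ[x]

-- A record, so that u and v can be inferred from the type of a proof.
infix 4 _≐_
record _≐_ (u v : Poly) : Set where
  constructor mk≐
  field coeff-≡ : ∀ i → coeff u i ≡ coeff v i
open _≐_ public

≐-setoid : Setoid 0ℓ 0ℓ
≐-setoid = record
  { Carrier = Poly
  ; _≈_ = _≐_
  ; isEquivalence = record
    { refl  = mk≐ λ i → ≡.refl
    ; sym   = λ e → mk≐ λ i → ≡.sym (coeff-≡ e i)
    ; trans = λ e e' → mk≐ λ i → ≡.trans (coeff-≡ e i) (coeff-≡ e' i)
    }
  }

open Setoid ≐-setoid using (refl; sym; trans)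

∷-cong : ∀ {a b u v} → a ≡ b → u ≐ v → a ∷ u ≐ b ∷ v
∷-cong a≡b u≐v = mk≐ λ { zero → a≡b ; (suc i) → coeff-≡ u≐v i }

0∷[]≐[] : X· [] ≐ []
0∷[]≐[] = mk≐ λ { zero → ≡.refl ; (suc i) → ≡.refl }

coeffwise₂ : ∀ u v u' v' → (∀ i → coeff u i +ℚ coeff v i ≡ coeff u' i +ℚ coeff v' i) →
             u +ₚ v ≐ u' +ₚ v'
coeffwise₂ u v u' v' e =
  mk≐ λ i → ≡.trans (coeff-+ₚ u v i) (≡.trans (e i) (≡.sym (coeff-+ₚ u' v' i)))

+ₚ-cong : ∀ {u u' v v'} → u ≐ u' → v ≐ v' → u +ₚ v ≐ u' +ₚ v'
+ₚ-cong {u} {u'} {v} {v'} e e' = coeffwise₂ u v u' v' λ i → ≡.cong₂ _+ℚ_ (coeff-≡ e i) (coeff-≡ e' i)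

+ₚ-assoc : ∀ u v w → (u +ₚ v) +ₚ w ≐ u +ₚ (v +ₚ w)
+ₚ-assoc u v w = coeffwise₂ (u +ₚ v) w u (v +ₚ w) λ i →
  ≡.trans (≡.cong (_+ℚ coeff w i) (coeff-+ₚ u v i))
  (≡.trans (ℚ.+-assoc (coeff u i) (coeff v i) (coeff w i))
           (≡.cong (coeff u i +ℚ_) (≡.sym (coeff-+ₚ v w i))))

+ₚ-comm : ∀ u v → u +ₚ v ≐ v +ₚ u
+ₚ-comm u v = coeffwise₂ u v v u λ i → ℚ.+-comm (coeff u i) (coeff v i)

+ₚ-commutativeMonoid : CommutativeMonoid 0ℓ 0ℓ
+ₚ-commutativeMonoid = record
  { _≈_ = _≐_
  ; _∙_ = _+ₚ_
  ; ε = []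
  ; isCommutativeMonoid = record
    { isMonoid = record
      { isSemigroup = record
        { isMagma = record
          { isEquivalence = Setoid.isEquivalence ≐-setoid
          ; ∙-cong = +ₚ-cong
          }
        ; assoc = +ₚ-assoc
        }
      ; identity = (λ u → refl) , λ u → +ₚ-comm u []
      }
    ; comm = +ₚ-comm
    }
  }

open CommutativeMonoid +ₚ-commutativeMonoid using ()
  renaming (identityʳ to +ₚ-identityʳ; ∙-congˡ to +ₚ-congˡ; ∙-congʳ to +ₚ-congʳ)
open import Algebra.Properties.CommutativeSemigroup
  (CommutativeMonoid.commutativeSemigroup +ₚ-commutativeMonoid)
  using (interchange; x∙yz≈y∙xz)
import Relation.Binary.Reasoning.Setoid ≐-setoid as ≐-Reasoning

coeffwise-· : ∀ c u {v} → (∀ i → c *ℚ coeff u i ≡ coeff v i) → c ·ₚ u ≐ v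
coeffwise-· c u e = mk≐ λ i → ≡.trans (coeff-·ₚ c u i) (e i)

·ₚ-congˡ : ∀ c {u v} → u ≐ v → c ·ₚ u ≐ c ·ₚ v
·ₚ-congˡ c {u} {v} e =
  coeffwise-· c u λ i → ≡.trans (≡.cong (c *ℚ_) (coeff-≡ e i)) (≡.sym (coeff-·ₚ c v i))

·ₚ-distribˡ : ∀ c u v → c ·ₚ (u +ₚ v) ≐ (c ·ₚ u) +ₚ (c ·ₚ v)
·ₚ-distribˡ c u v = coeffwise-· c (u +ₚ v) λ i →
  ≡.trans (≡.cong (c *ℚ_) (coeff-+ₚ u v i))
  (≡.trans (ℚ.*-distribˡ-+ c (coeff u i) (coeff v i))
  (≡.sym (≡.trans (coeff-+ₚ (c ·ₚ u) (c ·ₚ v) i)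
                  (≡.cong₂ _+ℚ_ (coeff-·ₚ c u i) (coeff-·ₚ c v i)))))

·ₚ-distribʳ : ∀ u c d → (c +ℚ d) ·ₚ u ≐ (c ·ₚ u) +ₚ (d ·ₚ u)
·ₚ-distribʳ u c d = coeffwise-· (c +ℚ d) u λ i →
  ≡.trans (ℚ.*-distribʳ-+ (coeff u i) c d)
  (≡.sym (≡.trans (coeff-+ₚ (c ·ₚ u) (d ·ₚ u) i)
                  (≡.cong₂ _+ℚ_ (coeff-·ₚ c u i) (coeff-·ₚ d u i))))

·ₚ-assoc : ∀ c d u → (c *ℚ d) ·ₚ u ≐ c ·ₚ (d ·ₚ u)
·ₚ-assoc c d u = coeffwise-· (c *ℚ d) u λ i →
  ≡.trans (ℚ.*-assoc c d (coeff u i))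
  (≡.sym (≡.trans (coeff-·ₚ c (d ·ₚ u) i) (≡.cong (c *ℚ_) (coeff-·ₚ d u i))))

·ₚ-identityˡ : ∀ u → 1ℚ ·ₚ u ≐ u
·ₚ-identityˡ u = coeffwise-· 1ℚ u λ i → ℚ.*-identityˡ (coeff u i)

·ₚ-zeroˡ : ∀ u → 0ℚ ·ₚ u ≐ []
·ₚ-zeroˡ u = coeffwise-· 0ℚ u λ i → ℚ.*-zeroˡ (coeff u i)

*ₚ-zeroʳ : ∀ u → u *ₚ [] ≐ []
*ₚ-zeroʳ []      = refl
*ₚ-zeroʳ (a ∷ u) = trans (∷-cong ≡.refl (*ₚ-zeroʳ u)) 0∷[]≐[]

X·-*ₚ : ∀ u v → (X· u) *ₚ v ≐ X· (u *ₚ v)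
X·-*ₚ u v = +ₚ-congʳ (·ₚ-zeroˡ v)

-- Mirror image of the defining recursion, on the right factor; comparing the two gives
-- commutativity.
*ₚ-∷ : ∀ u b v → u *ₚ (b ∷ v) ≐ (b ·ₚ u) +ₚ (X· (u *ₚ v))
*ₚ-∷ []      b v = sym 0∷[]≐[]
*ₚ-∷ (a ∷ u) b v = ∷-cong (≡.cong (_+ℚ 0ℚ) (ℚ.*-comm a b)) (begin
  (a ·ₚ v) +ₚ (u *ₚ (b ∷ v))                   ≈⟨ +ₚ-congˡ (*ₚ-∷ u b v) ⟩
  (a ·ₚ v) +ₚ ((b ·ₚ u) +ₚ (X· (u *ₚ v)))      ≈⟨ x∙yz≈y∙xz (a ·ₚ v) (b ·ₚ u) (X· (u *ₚ v)) ⟩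
  (b ·ₚ u) +ₚ ((a ∷ u) *ₚ v)                   ∎)
  where open ≐-Reasoning

*ₚ-comm : ∀ u v → u *ₚ v ≐ v *ₚ u
*ₚ-comm []      v = sym (*ₚ-zeroʳ v)
*ₚ-comm (a ∷ u) v = begin
  (a ·ₚ v) +ₚ (X· (u *ₚ v)) ≈⟨ +ₚ-congˡ (∷-cong ≡.refl (*ₚ-comm u v)) ⟩
  (a ·ₚ v) +ₚ (X· (v *ₚ u)) ≈⟨ *ₚ-∷ v a u ⟨
  v *ₚ (a ∷ u)              ∎
  where open ≐-Reasoning

*ₚ-congˡ : ∀ u {v v'} → v ≐ v' → u *ₚ v ≐ u *ₚ v'
*ₚ-congˡ []      e = refl
*ₚ-congˡ (a ∷ u) e = +ₚ-cong (·ₚ-congˡ a e) (∷-cong ≡.refl (*ₚ-congˡ u e))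

-- The recursion of `*ₚ` follows the list of its left factor, and equal polynomials may have lists
-- of different lengths. So the left factor is replaced after being commuted to the right.
*ₚ-cong : ∀ {u u' v v'} → u ≐ u' → v ≐ v' → u *ₚ v ≐ u' *ₚ v'
*ₚ-cong {u} {u'} {v} {v'} e e' = begin
  u *ₚ v   ≈⟨ *ₚ-congˡ u e' ⟩
  u *ₚ v'  ≈⟨ *ₚ-comm u v' ⟩
  v' *ₚ u  ≈⟨ *ₚ-congˡ v' e ⟩
  v' *ₚ u' ≈⟨ *ₚ-comm v' u' ⟩
  u' *ₚ v' ∎
  where open ≐-Reasoning

*ₚ-distribʳ : ∀ w u v → (u +ₚ v) *ₚ w ≐ (u *ₚ w) +ₚ (v *ₚ w)
*ₚ-distribʳ w []      v       = refl
*ₚ-distribʳ w (a ∷ u) []      = sym (+ₚ-identityʳ _)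
*ₚ-distribʳ w (a ∷ u) (b ∷ v) = begin
  ((a +ℚ b) ·ₚ w) +ₚ (X· ((u +ₚ v) *ₚ w))
    ≈⟨ +ₚ-cong (·ₚ-distribʳ w a b) (∷-cong ≡.refl (*ₚ-distribʳ w u v)) ⟩
  ((a ·ₚ w) +ₚ (b ·ₚ w)) +ₚ ((X· (u *ₚ w)) +ₚ (X· (v *ₚ w)))
    ≈⟨ interchange (a ·ₚ w) (b ·ₚ w) (X· (u *ₚ w)) (X· (v *ₚ w)) ⟩
  ((a ∷ u) *ₚ w) +ₚ ((b ∷ v) *ₚ w) ∎
  where open ≐-Reasoning

·ₚ-*ₚ : ∀ c u v → (c ·ₚ u) *ₚ v ≐ c ·ₚ (u *ₚ v)
·ₚ-*ₚ c []      v = refl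
·ₚ-*ₚ c (a ∷ u) v = begin
  ((c *ℚ a) ·ₚ v) +ₚ (X· ((c ·ₚ u) *ₚ v))
    ≈⟨ +ₚ-cong (·ₚ-assoc c a v) (∷-cong (≡.sym (ℚ.*-zeroʳ c)) (·ₚ-*ₚ c u v)) ⟩
  (c ·ₚ (a ·ₚ v)) +ₚ (c ·ₚ (X· (u *ₚ v)))
    ≈⟨ ·ₚ-distribˡ c (a ·ₚ v) (X· (u *ₚ v)) ⟨
  c ·ₚ ((a ∷ u) *ₚ v) ∎
  where open ≐-Reasoning

*ₚ-assoc : ∀ u v w → (u *ₚ v) *ₚ w ≐ u *ₚ (v *ₚ w)
*ₚ-assoc []      v w = refl
*ₚ-assoc (a ∷ u) v w = begin
  ((a ·ₚ v) +ₚ (X· (u *ₚ v))) *ₚ w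
    ≈⟨ *ₚ-distribʳ w (a ·ₚ v) (X· (u *ₚ v)) ⟩
  ((a ·ₚ v) *ₚ w) +ₚ ((X· (u *ₚ v)) *ₚ w)
    ≈⟨ +ₚ-cong (·ₚ-*ₚ a v w) (trans (X·-*ₚ (u *ₚ v) w) (∷-cong ≡.refl (*ₚ-assoc u v w))) ⟩
  (a ·ₚ (v *ₚ w)) +ₚ (X· (u *ₚ (v *ₚ w))) ∎
  where open ≐-Reasoning

const-*ₚ : ∀ c u → (c ∷ []) *ₚ u ≐ c ·ₚ u
const-*ₚ c u = trans (+ₚ-congˡ 0∷[]≐[]) (+ₚ-identityʳ (c ·ₚ u))

*ₚ-identityˡ : ∀ u → (1ℚ ∷ []) *ₚ u ≐ u
*ₚ-identityˡ u = trans (const-*ₚ 1ℚ u) (·ₚ-identityˡ u)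

polySemiring : CommutativeSemiring 0ℓ 0ℓ
polySemiring = record
  { _≈_ = _≐_
  ; _+_ = _+ₚ_
  ; _*_ = _*ₚ_
  ; 0# = []
  ; 1# = 1ℚ ∷ []
  ; isCommutativeSemiring = isCommutativeSemiringˡ record
    { +-isCommutativeMonoid = CommutativeMonoid.isCommutativeMonoid +ₚ-commutativeMonoid
    ; *-isCommutativeMonoid = record
      { isMonoid = record
        { isSemigroup = record
          { isMagma = record
            { isEquivalence = Setoid.isEquivalence ≐-setoid
            ; ∙-cong = *ₚ-cong
            }
          ; assoc = *ₚ-assoc
          }
        ; identity = *ₚ-identityˡ , λ u → trans (*ₚ-comm u (1ℚ ∷ [])) (*ₚ-identityˡ u)
        }
      ; comm = *ₚ-comm
      }
    ; distribʳ = *ₚ-distribʳ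
    ; zeroˡ = λ u → refl
    }
  }

private module polySemiring = CommutativeSemiring polySemiring

-- Uniqueness of division with remainder

open Algebra.Properties.Group ℚ.+-0-group using () renaming (∙-cancelˡ to +ℚ-cancelˡ)

a-b≡0⇒a≡b : ∀ a b → a +ℚ (- 1ℚ) *ℚ b ≡ 0ℚ → a ≡ b
a-b≡0⇒a≡b a b e = ≡.trans (split a b) (≡.trans (≡.cong (_+ℚ b) e) (ℚ.+-identityˡ b))
  where
  open +-*-Solver
  split : ∀ a b → a ≡ (a +ℚ (- 1ℚ) *ℚ b) +ℚ b
  split = solve 2 (λ a b → a := (a :+ con (- 1ℚ) :* b) :+ b) ≡.refl

a≡b⇒a-b≡0 : ∀ a b → a ≡ b → a +ℚ (- 1ℚ) *ℚ b ≡ 0ℚ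
a≡b⇒a-b≡0 a _ ≡.refl = solve 1 (λ a → a :+ con (- 1ℚ) :* a := con 0ℚ) ≡.refl a
  where open +-*-Solver

coeff-≥deg : ∀ v {i} → deg v ℕ.≤ i → coeff v (suc i) ≡ 0ℚ
coeff-≥deg []      d≤i = ≡.refl
coeff-≥deg (_ ∷ v) d≤i = coeff-≥length v _ d≤i

Reduced : Poly → Poly → Set
Reduced v r = ∀ i → deg v ℕ.≤ i → coeff r i ≡ 0ℚ

-- A degree argument that never names the degree of `w`. Beyond position deg v all coefficients of
-- `v` vanish, so the high coefficients of (a + x w) v are those of w v shifted by one, and
-- induction gives w = 0. Then the coefficient at deg v is `a` times 1.
*-reduced : ∀ w v → Monic v → Reduced v (w *ₚ v) → w ≐ []
*-reduced []      v monic red = refl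
*-reduced (a ∷ w) v monic red = trans (∷-cong a≡0 w≐[]) 0∷[]≐[]
  where
  coeff-aw*v : ∀ i → coeff ((a ∷ w) *ₚ v) i ≡ a *ℚ coeff v i +ℚ coeff (X· (w *ₚ v)) i
  coeff-aw*v i = ≡.trans (coeff-+ₚ (a ·ₚ v) (X· (w *ₚ v)) i)
                         (≡.cong (_+ℚ coeff (X· (w *ₚ v)) i) (coeff-·ₚ a v i))

  w≐[] : w ≐ []
  w≐[] = *-reduced w v monic λ i d≤i → let open ≡.≡-Reasoning in begin
    coeff (w *ₚ v) i                               ≡⟨ ℚ.+-identityˡ _ ⟨
    0ℚ +ℚ coeff (w *ₚ v) i                         ≡⟨ ≡.cong (_+ℚ coeff (w *ₚ v) i) (ℚ.*-zeroʳ a) ⟨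
    a *ℚ 0ℚ +ℚ coeff (w *ₚ v) i                    ≡⟨ ≡.cong (λ t → a *ℚ t +ℚ coeff (w *ₚ v) i) (coeff-≥deg v d≤i) ⟨
    a *ℚ coeff v (suc i) +ℚ coeff (w *ₚ v) i       ≡⟨ coeff-aw*v (suc i) ⟨
    coeff ((a ∷ w) *ₚ v) (suc i)                   ≡⟨ red (suc i) (ℕ.m≤n⇒m≤1+n d≤i) ⟩
    0ℚ                                             ∎

  a≡0 : a ≡ 0ℚ
  a≡0 = let open ≡.≡-Reasoning ; d = deg v in begin
    a                                              ≡⟨ ℚ.*-identityʳ a ⟨
    a *ℚ 1ℚ                                        ≡⟨ ≡.cong (a *ℚ_) monic ⟨
    a *ℚ coeff v d                                 ≡⟨ ℚ.+-identityʳ _ ⟨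
    a *ℚ coeff v d +ℚ 0ℚ                           ≡⟨ ≡.cong (a *ℚ coeff v d +ℚ_) (coeff-≡ (trans (∷-cong ≡.refl (*ₚ-cong w≐[] refl)) 0∷[]≐[]) d) ⟨
    a *ℚ coeff v d +ℚ coeff (X· (w *ₚ v)) d        ≡⟨ coeff-aw*v d ⟨
    coeff ((a ∷ w) *ₚ v) d                         ≡⟨ red d ℕ.≤-refl ⟩
    0ℚ                                             ∎

-- The hypothesis says (q - q') v = r' - r, which has no coefficients from deg v on, so `*-reduced`
-- forces q = q'.
division-unique : ∀ v → Monic v → ∀ q q' {r r'} → Reduced v r → Reduced v r' →
                  (q *ₚ v) +ₚ r ≐ (q' *ₚ v) +ₚ r' → r ≐ r'
division-unique v monic q q' {r} {r'} red red' e =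
  mk≐ λ i → +ℚ-cancelˡ (coeff (q' *ₚ v) i) _ _
    (≡.subst (λ t → t +ℚ coeff r i ≡ coeff (q' *ₚ v) i +ℚ coeff r' i) (qv≡q'v i) (eᵢ i))
  where
  w = q -ₚ q'

  coeff-w*v : ∀ i → coeff (w *ₚ v) i ≡ coeff (q *ₚ v) i +ℚ (- 1ℚ) *ℚ coeff (q' *ₚ v) i
  coeff-w*v i =
    ≡.trans (coeff-≡ (trans (*ₚ-distribʳ v q ((- 1ℚ) ·ₚ q')) (+ₚ-congˡ (·ₚ-*ₚ (- 1ℚ) q' v))) i)
    (≡.trans (coeff-+ₚ (q *ₚ v) _ i) (≡.cong (coeff (q *ₚ v) i +ℚ_) (coeff-·ₚ (- 1ℚ) (q' *ₚ v) i)))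

  eᵢ : ∀ i → coeff (q *ₚ v) i +ℚ coeff r i ≡ coeff (q' *ₚ v) i +ℚ coeff r' i
  eᵢ i = ≡.trans (≡.sym (coeff-+ₚ (q *ₚ v) r i)) (≡.trans (coeff-≡ e i) (coeff-+ₚ (q' *ₚ v) r' i))

  w≐[] : w ≐ []
  w≐[] = *-reduced w v monic λ i d≤i → ≡.trans (coeff-w*v i)
    (a≡b⇒a-b≡0 (coeff (q *ₚ v) i) (coeff (q' *ₚ v) i)
    (≡.trans (≡.sym (ℚ.+-identityʳ _))
    (≡.trans (≡.cong (coeff (q *ₚ v) i +ℚ_) (≡.sym (red i d≤i)))
    (≡.trans (eᵢ i)
    (≡.trans (≡.cong (coeff (q' *ₚ v) i +ℚ_) (red' i d≤i)) (ℚ.+-identityʳ _))))))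

  qv≡q'v : ∀ i → coeff (q *ₚ v) i ≡ coeff (q' *ₚ v) i
  qv≡q'v i = a-b≡0⇒a≡b _ _ (≡.trans (≡.sym (coeff-w*v i)) (coeff-≡ (*ₚ-cong w≐[] (refl {v})) i))

quotRem-≐ : ∀ u v → u ≐ (u quot v) *ₚ v +ₚ (u rem v)
quotRem-≐ u v = mk≐ (quotRem-correct u v)

-- Linearity of the remainder

module _ (v : Poly) (monic : Monic v) where
  open ≐-Reasoning

  -- The laws of `rem` below are read off from decompositions u = q v + r, not from the recursion of
  -- `quotRem`, which depends on the list chosen to represent `u`.
  rem-unique : ∀ {u} q {r} → Reduced v r → u ≐ (q *ₚ v) +ₚ r → u rem v ≐ r
  rem-unique {u} q red e = division-unique v monic (u quot v) q (rem-deg< u v monic) red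
    (trans (sym (quotRem-≐ u v)) e)

  rem-cong : ∀ {u u'} → u ≐ u' → u rem v ≐ u' rem v
  rem-cong {u} {u'} e =
    rem-unique (u' quot v) (rem-deg< u' v monic) (trans e (quotRem-≐ u' v))

  rem-+ : ∀ u u' → (u +ₚ u') rem v ≐ (u rem v) +ₚ (u' rem v)
  rem-+ u u' = rem-unique (u quot v +ₚ u' quot v)
    (λ i d≤i → ≡.trans (coeff-+ₚ (u rem v) (u' rem v) i)
                       (≡.cong₂ _+ℚ_ (rem-deg< u v monic i d≤i) (rem-deg< u' v monic i d≤i)))
    (begin
      u +ₚ u'
        ≈⟨ +ₚ-cong (quotRem-≐ u v) (quotRem-≐ u' v) ⟩
      ((u quot v) *ₚ v +ₚ (u rem v)) +ₚ ((u' quot v) *ₚ v +ₚ (u' rem v))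
        ≈⟨ interchange ((u quot v) *ₚ v) (u rem v) ((u' quot v) *ₚ v) (u' rem v) ⟩
      ((u quot v) *ₚ v +ₚ (u' quot v) *ₚ v) +ₚ ((u rem v) +ₚ (u' rem v))
        ≈⟨ +ₚ-congʳ (*ₚ-distribʳ v (u quot v) (u' quot v)) ⟨
      (u quot v +ₚ u' quot v) *ₚ v +ₚ ((u rem v) +ₚ (u' rem v)) ∎)

  rem-· : ∀ c u → (c ·ₚ u) rem v ≐ c ·ₚ (u rem v)
  rem-· c u = rem-unique (c ·ₚ (u quot v))
    (λ i d≤i → ≡.trans (coeff-·ₚ c (u rem v) i)
                       (≡.trans (≡.cong (c *ℚ_) (rem-deg< u v monic i d≤i)) (ℚ.*-zeroʳ c)))
    (begin
      c ·ₚ u                                        ≈⟨ ·ₚ-congˡ c (quotRem-≐ u v) ⟩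
      c ·ₚ ((u quot v) *ₚ v +ₚ (u rem v))           ≈⟨ ·ₚ-distribˡ c ((u quot v) *ₚ v) (u rem v) ⟩
      c ·ₚ ((u quot v) *ₚ v) +ₚ c ·ₚ (u rem v)      ≈⟨ +ₚ-congʳ (·ₚ-*ₚ c (u quot v) v) ⟨
      (c ·ₚ (u quot v)) *ₚ v +ₚ c ·ₚ (u rem v)      ∎)

  rem-multiple : ∀ w → (w *ₚ v) rem v ≐ []
  rem-multiple w = rem-unique w (λ i _ → ≡.refl) (sym (+ₚ-identityʳ (w *ₚ v)))

-- The localization ℤ₍ₚ₎ and the ring ℤ₍ₚ₎[x]/(Ψ m, p)

x*ₚ : ∀ u → (X· (1ℚ ∷ [])) *ₚ u ≐ X· u
x*ₚ u = trans (X·-*ₚ (1ℚ ∷ []) u) (∷-cong ≡.refl (*ₚ-identityˡ u))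

-- By definition the new 1 of Ψ (m + 1) is put at the constant term; here it is put at the top
-- degree.
Ψ-suc : ∀ m → Ψ (suc m) ≐ ((X· (1ℚ ∷ [])) ^ₚ m) +ₚ Ψ m
Ψ-suc zero    = refl
Ψ-suc (suc m) = sym (trans
  (+ₚ-congʳ {x = Ψ (suc m)} (x*ₚ ((X· (1ℚ ∷ [])) ^ₚ m)))
  (∷-cong (ℚ.+-identityˡ 1ℚ) (sym (Ψ-suc m))))

-- `_/_` cancels a gcd and does not reduce on a variable, so the identity is checked on unnormalised
-- fractions, here and in `/1-*-1/`.
suc/1 : ∀ n → + suc n / 1 ≡ 1ℚ +ℚ (+ n / 1)
suc/1 n = ℚ.toℚᵘ-injective (begin-equality
  toℚᵘ (+ suc n / 1)                        ≃⟨ ℚ.toℚᵘ-fromℚᵘ (ℚᵘ.mkℚᵘ (+ suc n) 0) ⟩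
  ℚᵘ.mkℚᵘ (+ suc n) 0                       ≃⟨ ℚᵘ.*≡* (≡.cong (λ k → (ℤ.1ℤ ℤ.+ k) ℤ.* + 1) (≡.sym (ℤ.*-identityʳ (+ n)))) ⟩
  ℚᵘ.1ℚᵘ ℚᵘ.+ ℚᵘ.mkℚᵘ (+ n) 0               ≃⟨ ℚᵘ.+-congʳ ℚᵘ.1ℚᵘ (ℚ.toℚᵘ-fromℚᵘ (ℚᵘ.mkℚᵘ (+ n) 0)) ⟨
  ℚᵘ.1ℚᵘ ℚᵘ.+ toℚᵘ (+ n / 1)                ≃⟨ ℚ.toℚᵘ-homo-+ 1ℚ (+ n / 1) ⟨
  toℚᵘ (1ℚ +ℚ (+ n / 1))                    ∎)
  where open ℚᵘ.≤-Reasoning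

/1-*-1/ : ∀ m .{{_ : NonZero m}} → (+ m / 1) *ℚ (+ 1 / m) ≡ 1ℚ
/1-*-1/ m@(suc m-1) = ℚ.toℚᵘ-injective (begin-equality
  toℚᵘ ((+ m / 1) *ℚ (+ 1 / m))             ≃⟨ ℚ.toℚᵘ-homo-* (+ m / 1) (+ 1 / m) ⟩
  toℚᵘ (+ m / 1) ℚᵘ.* toℚᵘ (+ 1 / m)
    ≃⟨ ℚᵘ.*-cong (ℚ.toℚᵘ-fromℚᵘ (ℚᵘ.mkℚᵘ (+ m) 0)) (ℚ.toℚᵘ-fromℚᵘ (ℚᵘ.mkℚᵘ (+ 1) m-1)) ⟩
  ℚᵘ.mkℚᵘ (+ m) 0 ℚᵘ.* ℚᵘ.mkℚᵘ (+ 1) m-1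
    ≃⟨ ℚᵘ.*≡* (≡.cong +_ (≡.trans (ℕ.*-identityʳ _) (≡.trans (ℕ.*-comm m 1) (≡.sym (ℕ.*-identityˡ (1 ℕ.* m)))))) ⟩
  ℚᵘ.1ℚᵘ                                    ∎)
  where open ℚᵘ.≤-Reasoning

-- Rationals with denominator prime to p

module Localization {p : ℕ} (pr : Prime p) where

  private
    P : ℚ
    P = + p / 1

  -- A record, since `a` could not be inferred from the bare `p ∤ ↧ₙ a`.
  record Integral (a : ℚ) : Set where
    constructor mkIntegral
    field p∤↧ₙ : p ∤ ↧ₙ a
  open Integral

  *≡⇒∣ : ∀ i {j k} → i ℤ.* j ≡ k → ∣ i ∣ ∣ ∣ k ∣
  *≡⇒∣ i {j} ≡.refl = ≡.subst (∣ i ∣ ∣_) (≡.sym (ℤ.abs-* i j)) (m∣m*n ∣ j ∣)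

  private
    p∤1 : p ∤ 1
    p∤1 = prime∤1 pr

  ∤-* : ∀ {m n} → p ∤ m → p ∤ n → p ∤ m ℕ.* n
  ∤-* {m} {n} p∤m p∤n p∣mn = [ p∤m , p∤n ]′ (euclidsLemma m n pr p∣mn)

  -- The reduced denominator times the cancelled gcd is the unreduced one, hence divides it. The
  -- same argument serves sums and products.
  integral-/ : ∀ i n .{{_ : NonZero n}} → p ∤ n → Integral (i / n)
  integral-/ i n p∤n = mkIntegral λ p∣↧ → p∤n (∣-trans p∣↧ (*≡⇒∣ (↧ (i / n)) (ℚ.↧-/ i n)))

  integral-+ : ∀ {a b} → Integral a → Integral b → Integral (a +ℚ b)
  integral-+ {a} {b} ia ib = mkIntegral λ p∣↧ → ∤-* (p∤↧ₙ ia) (p∤↧ₙ ib) (∣-trans p∣↧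
    (≡.subst (↧ₙ (a +ℚ b) ∣_) (ℤ.abs-* (↧ a) (↧ b)) (*≡⇒∣ (↧ (a +ℚ b)) (ℚ.↧-+ a b))))

  integral-* : ∀ {a b} → Integral a → Integral b → Integral (a *ℚ b)
  integral-* {a} {b} ia ib = mkIntegral λ p∣↧ → ∤-* (p∤↧ₙ ia) (p∤↧ₙ ib) (∣-trans p∣↧
    (≡.subst (↧ₙ (a *ℚ b) ∣_) (ℤ.abs-* (↧ a) (↧ b)) (*≡⇒∣ (↧ (a *ℚ b)) (ℚ.↧-* a b))))

  integral-neg : ∀ {a} → Integral a → Integral (- a)
  integral-neg {a} ia = mkIntegral (≡.subst (p ∤_) (≡.sym (≡.cong ∣_∣ (ℚ.↧-neg a))) (p∤↧ₙ ia))

  integral-0 : Integral 0ℚ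
  integral-0 = mkIntegral p∤1

  integral-1 : Integral 1ℚ
  integral-1 = mkIntegral p∤1

  -- Here x / y is i / j after cancelling `g`. The prime cannot divide `g`, which divides `j`, so it
  -- survives in the numerator.
  p∣numerator : ∀ x y {g i j} → x ℤ.* g ≡ i → y ℤ.* g ≡ j → p ∣ ∣ i ∣ → p ∤ ∣ j ∣ → p ∣ ∣ x ∣
  p∣numerator x y {g} xg≡i yg≡j p∣i p∤j
    with euclidsLemma ∣ x ∣ ∣ g ∣ pr
           (≡.subst (p ∣_) (≡.trans (≡.cong ∣_∣ (≡.sym xg≡i)) (ℤ.abs-* x g)) p∣i)
  ... | inj₁ p∣x = p∣x
  ... | inj₂ p∣g = ⊥-elim (p∤j (∣-trans p∣g (*≡⇒∣ g (≡.trans (ℤ.*-comm g y) yg≡j))))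

  p∣↥P : p ∣ ∣ ↥ P ∣
  p∣↥P = p∣numerator (↥ P) (↧ P) (ℚ.↥-/ (+ p) 1) (ℚ.↧-/ (+ p) 1) ∣-refl p∤1

  p∣↥[P*] : ∀ {c} → Integral c → p ∣ ∣ ↥ (P *ℚ c) ∣
  p∣↥[P*] {c} ic = p∣numerator (↥ (P *ℚ c)) (↧ (P *ℚ c)) (ℚ.↥-* P c) (ℚ.↧-* P c)
    (≡.subst (p ∣_) (≡.sym (ℤ.abs-* (↥ P) (↥ c))) (∣m⇒∣m*n _ p∣↥P))
    (≡.subst (p ∤_) (≡.sym (ℤ.abs-* (↧ P) (↧ c))) (∤-* (p∤↧ₙ (integral-/ (+ p) 1 p∤1)) (p∤↧ₙ ic)))

  -- The cross difference in the definition of the congruence is the unreduced numerator of a - b.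
  ↥-- : ∀ a b → ∣ ↥ (a +ℚ - b) ∣ ∣ ∣ ↥ a ℤ.* ↧ b ℤ.- ↥ b ℤ.* ↧ a ∣
  ↥-- a b = *≡⇒∣ (↥ (a +ℚ - b)) (≡.trans (ℚ.↥-+ a (- b))
    (≡.cong₂ ℤ._+_ (≡.cong (↥ a ℤ.*_) (ℚ.↧-neg b))
      (≡.trans (≡.cong (ℤ._* ↧ a) (ℚ.↥-neg b)) (≡.sym (ℤ.neg-distribˡ-* (↥ b) (↧ a))))))

  -- The corrections on both sides match the two-sided form of `∼`; together they give a - b = P (c'
  -- - c).
  integral⇒≈ : ∀ {a b c c'} → Integral a → Integral b → Integral c → Integral c' →
               a +ℚ P *ℚ c ≡ b +ℚ P *ℚ c' → a ≈ b [mod p ]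
  integral⇒≈ {a} {b} {c} {c'} ia ib ic ic' e = mk≈ (p∤↧ₙ ia) (p∤↧ₙ ib)
    (∣-trans (≡.subst (λ d → p ∣ ∣ ↥ d ∣) (≡.sym a-b≡pd) (p∣↥[P*] (integral-+ ic' (integral-neg ic))))
             (↥-- a b))
    where
    open +-*-Solver
    a-b≡pd : a +ℚ - b ≡ P *ℚ (c' +ℚ - c)
    a-b≡pd = begin
      a +ℚ - b                              ≡⟨ solve 4 (λ a b P c → a :- b := (a :+ P :* c) :- b :- P :* c) ≡.refl a b P c ⟩
      (a +ℚ P *ℚ c) +ℚ - b +ℚ - (P *ℚ c)    ≡⟨ ≡.cong (λ t → t +ℚ - b +ℚ - (P *ℚ c)) e ⟩
      (b +ℚ P *ℚ c') +ℚ - b +ℚ - (P *ℚ c)   ≡⟨ solve 4 (λ b P c c' → (b :+ P :* c') :- b :- P :* c := P :* (c' :- c)) ≡.refl b P c c' ⟩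
      P *ℚ (c' +ℚ - c)                      ∎
      where open ≡.≡-Reasoning

  -- Polynomials over the localization

  IntegralPoly : Poly → Set
  IntegralPoly = All Integral

  integral-coeff : ∀ {u} → IntegralPoly u → ∀ i → Integral (coeff u i)
  integral-coeff []       i       = integral-0
  integral-coeff (ia ∷ _) zero    = ia
  integral-coeff (_ ∷ iu) (suc i) = integral-coeff iu i

  integral-+ₚ : ∀ {u v} → IntegralPoly u → IntegralPoly v → IntegralPoly (u +ₚ v)
  integral-+ₚ []        iv        = iv
  integral-+ₚ (ia ∷ iu) []        = ia ∷ iu
  integral-+ₚ (ia ∷ iu) (ib ∷ iv) = integral-+ ia ib ∷ integral-+ₚ iu iv

  integral-·ₚ : ∀ {c u} → Integral c → IntegralPoly u → IntegralPoly (c ·ₚ u)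
  integral-·ₚ ic []        = []
  integral-·ₚ ic (ia ∷ iu) = integral-* ic ia ∷ integral-·ₚ ic iu

  integral-*ₚ : ∀ {u v} → IntegralPoly u → IntegralPoly v → IntegralPoly (u *ₚ v)
  integral-*ₚ []        iv = []
  integral-*ₚ (ia ∷ iu) iv = integral-+ₚ (integral-·ₚ ia iv) (integral-0 ∷ integral-*ₚ iu iv)

  -- `quotRem` only adds, subtracts and multiplies coefficients, so `p` enters no denominator.
  integral-rem : ∀ {u v} → IntegralPoly u → IntegralPoly v → IntegralPoly (u rem v)
  integral-rem []        iv = []
  integral-rem {v = v} (ia ∷ iu) iv =
    integral-+ₚ ir (integral-·ₚ (integral-neg integral-1) (integral-·ₚ (integral-coeff ir (deg v)) iv))
    where ir = ia ∷ integral-rem iu iv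

  -- The quotient ring A

  module Reduction (m : ℕ) .{{_ : NonZero m}} where

    -- The integrality of `z` is essential: every rational polynomial is `P` times another one.
    record InIdeal (u : Poly) : Set where
      constructor mkInIdeal
      field
        {w z} : Poly
        w-int : IntegralPoly w
        z-int : IntegralPoly z
        u≐    : u ≐ w *ₚ Ψ m +ₚ P ·ₚ z

    integral-Ψ : IntegralPoly (Ψ m)
    integral-Ψ = All.replicate⁺ m integral-1

    ∈ideal-0 : InIdeal []
    ∈ideal-0 = mkInIdeal [] [] refl

    ∈ideal-+ : ∀ {u v} → InIdeal u → InIdeal v → InIdeal (u +ₚ v)
    ∈ideal-+ {u} {v} (mkInIdeal {w} {z} iw iz u≐) (mkInIdeal {w'} {z'} iw' iz' v≐) =
      mkInIdeal (integral-+ₚ iw iw') (integral-+ₚ iz iz') (begin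
        u +ₚ v
          ≈⟨ +ₚ-cong u≐ v≐ ⟩
        (w *ₚ Ψ m +ₚ P ·ₚ z) +ₚ (w' *ₚ Ψ m +ₚ P ·ₚ z')
          ≈⟨ interchange (w *ₚ Ψ m) (P ·ₚ z) (w' *ₚ Ψ m) (P ·ₚ z') ⟩
        (w *ₚ Ψ m +ₚ w' *ₚ Ψ m) +ₚ (P ·ₚ z +ₚ P ·ₚ z')
          ≈⟨ +ₚ-cong (*ₚ-distribʳ (Ψ m) w w') (·ₚ-distribˡ P z z') ⟨
        (w +ₚ w') *ₚ Ψ m +ₚ P ·ₚ (z +ₚ z') ∎)
      where open ≐-Reasoning

    ∈ideal-* : ∀ {u v} → IntegralPoly u → InIdeal v → InIdeal (u *ₚ v)
    ∈ideal-* {u} {v} iu (mkInIdeal {w} {z} iw iz v≐) =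
      mkInIdeal (integral-*ₚ iu iw) (integral-*ₚ iz iu) (begin
        u *ₚ v                                ≈⟨ *ₚ-congˡ u v≐ ⟩
        u *ₚ (w *ₚ Ψ m +ₚ P ·ₚ z)             ≈⟨ polySemiring.distribˡ u (w *ₚ Ψ m) (P ·ₚ z) ⟩
        u *ₚ (w *ₚ Ψ m) +ₚ u *ₚ (P ·ₚ z)      ≈⟨ +ₚ-cong (sym (*ₚ-assoc u w (Ψ m))) (*ₚ-comm u (P ·ₚ z)) ⟩
        (u *ₚ w) *ₚ Ψ m +ₚ (P ·ₚ z) *ₚ u      ≈⟨ +ₚ-congˡ (·ₚ-*ₚ P z u) ⟩
        (u *ₚ w) *ₚ Ψ m +ₚ P ·ₚ (z *ₚ u)      ∎)
      where open ≐-Reasoning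

    open SubQuotient polySemiring IntegralPoly
      [] (integral-1 ∷ []) integral-+ₚ integral-*ₚ
      InIdeal ∈ideal-0 ∈ideal-+ ∈ideal-*

    module A = CommutativeSemiring subQuotient
    open import Algebra.Properties.CommutativeSemiring.Exp subQuotient using (_^_)
    open import Algebra.Properties.Semiring.Mult A.semiring using () renaming (_×_ to _×ᴬ_)

    -- `rem` kills the multiple of `Ψ m` and leaves `P` times the remainder of `z`, which is again
    -- integral.
    rem-∈ideal : ∀ {u} → InIdeal u → ∃₂ λ (z : Poly) (iz : IntegralPoly z) → u rem Ψ m ≐ P ·ₚ z
    rem-∈ideal {u} (mkInIdeal {w} {z} iw iz u≐) = z rem Ψ m , integral-rem iz integral-Ψ , (begin
      u rem Ψ m                                      ≈⟨ rem-cong (Ψ m) monic u≐ ⟩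
      (w *ₚ Ψ m +ₚ P ·ₚ z) rem Ψ m                   ≈⟨ rem-+ (Ψ m) monic (w *ₚ Ψ m) _ ⟩
      (w *ₚ Ψ m) rem Ψ m +ₚ (P ·ₚ z) rem Ψ m         ≈⟨ +ₚ-cong (rem-multiple (Ψ m) monic w) (rem-· (Ψ m) monic P z) ⟩
      P ·ₚ (z rem Ψ m)                               ∎)
      where
      monic = Ψ-monic m
      open ≐-Reasoning

    ∼⇒rem≈ : ∀ {u v} → IntegralPoly u → IntegralPoly v → u ∼ v →
             u rem Ψ m ≈ₚ v rem Ψ m [mod p ]
    ∼⇒rem≈ {u} {v} iu iv (mk∼ {j} {k} j∈ k∈ e) n =
      integral⇒≈ (integral-coeff (integral-rem iu integral-Ψ) n)
                    (integral-coeff (integral-rem iv integral-Ψ) n)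
                    (integral-coeff iz n) (integral-coeff iz' n) (begin
        coeff (u rem Ψ m) n +ℚ P *ℚ coeff z n   ≡⟨ coeff-sum u z ⟨
        coeff (u rem Ψ m +ₚ P ·ₚ z) n           ≡⟨ coeff-≡ rems n ⟩
        coeff (v rem Ψ m +ₚ P ·ₚ z') n          ≡⟨ coeff-sum v z' ⟩
        coeff (v rem Ψ m) n +ℚ P *ℚ coeff z' n  ∎)
      where
      open ≡.≡-Reasoning
      z = proj₁ (rem-∈ideal j∈)
      iz = proj₁ (proj₂ (rem-∈ideal j∈))
      z' = proj₁ (rem-∈ideal k∈)
      iz' = proj₁ (proj₂ (rem-∈ideal k∈))
      j≐ = proj₂ (proj₂ (rem-∈ideal j∈))
      k≐ = proj₂ (proj₂ (rem-∈ideal k∈))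
      monic = Ψ-monic m

      coeff-sum : ∀ u z → coeff (u rem Ψ m +ₚ P ·ₚ z) n ≡ coeff (u rem Ψ m) n +ℚ P *ℚ coeff z n
      coeff-sum u z = ≡.trans (coeff-+ₚ (u rem Ψ m) (P ·ₚ z) n)
                              (≡.cong (coeff (u rem Ψ m) n +ℚ_) (coeff-·ₚ P z n))

      rems : u rem Ψ m +ₚ P ·ₚ z ≐ v rem Ψ m +ₚ P ·ₚ z'
      rems = trans (+ₚ-congˡ (sym j≐)) (trans (sym (rem-+ (Ψ m) monic u j))
            (trans (rem-cong (Ψ m) monic e) (trans (rem-+ (Ψ m) monic v k) (+ₚ-congˡ k≐))))

    const : ∀ {a} → Integral a → A.Carrier
    const {a} ia = a ∷ [] , ia ∷ []

    integral-ℕ : ∀ n → Integral (+ n / 1)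
    integral-ℕ n = integral-/ (+ n) 1 p∤1

    X : A.Carrier
    X = X· (1ℚ ∷ []) , integral-0 ∷ integral-1 ∷ []

    -- Serves twice: at `p` it yields the characteristic of A, and at every `n` it shows that
    -- integer constants are fixed.
    ×1≈const : ∀ n → n ×ᴬ A.1# A.≈ const (integral-ℕ n)
    ×1≈const zero    = mk≋ (≈⇒∼ (sym 0∷[]≐[]))
    ×1≈const (suc n) = A.trans (A.+-congˡ (×1≈const n))
      (mk≋ (≈⇒∼ (∷-cong (≡.sym (suc/1 n)) refl)))

    p×1≈0 : p ×ᴬ A.1# A.≈ A.0#
    -- In the two-sided relation the right side 0 is corrected by P = 0 · Ψ m + P · 1.
    p×1≈0 = A.trans (×1≈const p) (mk≋ (mk∼ {k = P ∷ []}
      ∈ideal-0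
      (mkInIdeal [] (integral-1 ∷ []) (∷-cong (≡.sym (ℚ.*-identityʳ P)) refl))
      refl))

    -- An equality of lists, not just `≐`, so that it can be substituted under `rem` in `f`.
    proj₁-^ : ∀ x n → proj₁ (x ^ n) ≡ proj₁ x ^ₚ n
    proj₁-^ x zero    = ≡.refl
    proj₁-^ x (suc n) = ≡.cong (proj₁ x *ₚ_) (proj₁-^ x n)

    X^m≈1 : X ^ m A.≈ A.1#
    X^m≈1 = mk≋ (≡.subst (_∼ 1ℚ ∷ []) (≡.sym (proj₁-^ X m)) (mk∼ Ψ∈ideal XΨ∈ideal x^m+Ψ≐1+xΨ))
      where
      Ψ∈ideal : InIdeal (Ψ m)
      Ψ∈ideal = mkInIdeal (integral-1 ∷ []) [] (sym (trans (+ₚ-identityʳ _) (*ₚ-identityˡ (Ψ m))))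

      XΨ∈ideal : InIdeal (X· Ψ m)
      XΨ∈ideal = mkInIdeal (proj₂ X) [] (sym (trans (+ₚ-identityʳ _) (x*ₚ (Ψ m))))

      -- Both sides equal Ψ (m + 1): this is x^m - 1 = (x - 1) Ψ m written without subtraction.
      x^m+Ψ≐1+xΨ : (proj₁ X ^ₚ m) +ₚ Ψ m ≐ (1ℚ ∷ []) +ₚ (X· Ψ m)
      x^m+Ψ≐1+xΨ = trans (sym (Ψ-suc m)) (∷-cong (≡.sym (ℚ.+-identityʳ 1ℚ)) refl)

    integral-derivFrom : ∀ k {u} → IntegralPoly u → IntegralPoly (derivFrom k u)
    integral-derivFrom k []        = []
    integral-derivFrom k (ia ∷ iu) = integral-* (integral-ℕ k) ia ∷ integral-derivFrom (suc k) iu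

    integral-deriv : ∀ {u} → IntegralPoly u → IntegralPoly (deriv u)
    integral-deriv []       = []
    integral-deriv (_ ∷ iu) = integral-derivFrom 1 iu

    -- The base of the powers is a fixed point

    module _ (p∤m : p ∤ m) (s : ℕ) (pˢ≡1 : (p ℕ.^ s) ℕ.% m ≡ 1 ℕ.% m) where
      open Frobenius.Fixed subQuotient pr p×1≈0 s

      -- Fermat's little theorem in A: `n` is a sum of ones.
      fixed-ℕ : ∀ n → Fixed (const (integral-ℕ n))
      fixed-ℕ n = fixed-cong (×1≈const n) (fixed-×1 n)
        where
        fixed-×1 : ∀ n → Fixed (n ×ᴬ A.1#)
        fixed-×1 zero    = fixed-0
        fixed-×1 (suc n) = fixed-+ fixed-1 (fixed-×1 n)

      fixed-X : Fixed X
      fixed-X = fixed-root m X^m≈1 pˢ≡1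

      integral-1/m : Integral (+ 1 / m)
      integral-1/m = integral-/ (+ 1) m p∤m

      fixed-1/m : Fixed (const integral-1/m)
      fixed-1/m = fixed-inverse m*1/m≈1 (fixed-ℕ m)
        where
        m*1/m≈1 : const (integral-ℕ m) A.* const integral-1/m A.≈ A.1#
        m*1/m≈1 = mk≋ (≈⇒∼ (trans (const-*ₚ (+ m / 1) ((+ 1 / m) ∷ [])) (∷-cong (/1-*-1/ m) refl)))

      -- Horner's rule: the list stands for a + x u. This passes from fixed coefficients to fixed
      -- polynomials.
      fixed-∷ : ∀ {a u} (ia : Integral a) (iu : IntegralPoly u) →
                Fixed (const ia) → Fixed (u , iu) → Fixed (a ∷ u , ia ∷ iu)
      fixed-∷ {a} {u} ia iu fa fu = fixed-cong
        (mk≋ (≈⇒∼ (trans (+ₚ-congˡ {x = a ∷ []} (x*ₚ u)) (∷-cong (ℚ.+-identityʳ a) refl))))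
        (fixed-+ fa (fixed-* fixed-X fu))

      -- The integrality proof is a component of the element of A, so the claim ranges over all such
      -- proofs and fits whichever one is attached.
      fixed-derivFrom : ∀ k j (i : IntegralPoly (derivFrom k (replicate j 1ℚ))) → Fixed (_ , i)
      fixed-derivFrom k zero    []        = fixed-0
      fixed-derivFrom k (suc j) (ia ∷ iu) = fixed-∷ ia iu
        (fixed-cong (mk≋ (≈⇒∼ (∷-cong (≡.sym (ℚ.*-identityʳ (+ k / 1))) refl))) (fixed-ℕ k))
        (fixed-derivFrom (suc k) j iu)

      fixed-derivΨ : ∀ j (i : IntegralPoly (deriv (Ψ j))) → Fixed (_ , i)
      fixed-derivΨ zero    [] = fixed-0
      fixed-derivΨ (suc j) i  = fixed-derivFrom 1 j i

      XΨ' : A.Carrier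
      XΨ' = X· deriv (Ψ m) , integral-0 ∷ integral-deriv integral-Ψ

      -- The underlying list is literally the base of the power in `f`; `fixed-g` trades the scalar
      -- multiple for a product with a constant.
      g : A.Carrier
      g = (+ 1 / m) ·ₚ proj₁ XΨ' , integral-·ₚ integral-1/m (proj₂ XΨ')

      fixed-g : Fixed g
      fixed-g = fixed-cong (mk≋ (≈⇒∼ (const-*ₚ (+ 1 / m) (proj₁ XΨ'))))
        (fixed-* fixed-1/m
          (fixed-∷ integral-0 (integral-deriv integral-Ψ) (fixed-ℕ 0)
            (fixed-derivΨ m (integral-deriv integral-Ψ))))

      f-period : ∀ n .{{_ : NonZero n}} → f m ((p ℕ.^ s ℕ.∸ 1) ℕ.+ n) ≈ₚ f m n [mod p ]
      f-period n =
        ≡.subst₂ (λ u v → u rem Ψ m ≈ₚ v rem Ψ m [mod p ])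
          (proj₁-^ g ((p ℕ.^ s ℕ.∸ 1) ℕ.+ n)) (proj₁-^ g n)
          (∼⇒rem≈ (proj₂ (g ^ ((p ℕ.^ s ℕ.∸ 1) ℕ.+ n))) (proj₂ (g ^ n))
                  (rel (fixed-period fixed-g n)))

open import Data.Nat.Base using (_+_; _∸_; _^_; _%_)

theorem4p1 : (m : ℕ) .{{_ : NonZero m}} (p : ℕ) → Prime p → gcd m p ≡ 1 →
    (s : ℕ) .{{_ : NonZero s}} → (p ^ s) % m ≡ 1 % m →
    (n : ℕ) .{{_ : NonZero n}} →
    f m ((p ^ s ∸ 1) + n) ≈ₚ f m n [mod p ]
theorem4p1 m p pr gcd≡1 s pˢ≡1 n = Localization.Reduction.f-period pr m p∤m s pˢ≡1 n
  where
  p∤m : p ∤ m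
  p∤m p∣m = prime∤1 pr (≡.subst (p ∣_) gcd≡1 (gcd-greatest p∣m ∣-refl))
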